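{- Let $n \ge m$ be natural numbers and let $g(x)=a_m x^m + \dots + a_1 x + a_0$ be a polynomial with integer coefficients. Then \[ \sum_{k=0}^{n} g(k)\binom{n}{k}\, d(n-k) = \left(\sum_{i=0}^{m} a_i B_i\right) n!. \]
   Context: For a nonnegative integer $r$, $d(r)$ denotes the number of derangements of $\{1,\dots,r\}$ (permutations with no fixed point), with $d(0)=1$. $B_i$ denotes the $i$-th Bell number, the number of partitions of an $i$-element set into nonempty blocks, with $B_0=1$. -}

module Defs where

open import Data.Fin using (Fin; toℕ; _≟_)
open import Data.Fin.Properties using (all?; any?)
open import Data.Fin.Subset using (Subset; inside; outside; Nonempty; Empty; _∈_; _∩_)
open import Data.Fin.Subset.Properties using (nonempty?; _∈?_)
open import Data.Integer using (ℤ; _*_; _^_)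
open import Data.Integer.Properties using (+-0-monoid)
open import Algebra.Properties.Monoid.Sum +-0-monoid public using (sum⁺-syntax)
open import Data.List using (List; []; _∷_; _++_; map; filter; length; allFin; cartesianProductWith)
open import Data.List.Relation.Unary.All as All using (All)
open import Data.List.Relation.Unary.AllPairs as AllPairs using (AllPairs)
open import Data.List.Relation.Unary.Any as Any using (Any)
open import Data.Nat using (ℕ; zero; suc)
open import Data.Product using (_×_; _,_)
open import Data.Vec as Vec using (Vec; lookup)
open import Data.Vec.Functional using (Vector)
open import Function.Definitions using (Bijective)
open import Relation.Binary.PropositionalEquality using (_≡_; _≢_; refl)
open import Relation.Nullary using (Dec; ¬?)
open import Relation.Nullary.Decidable using (map′; _×-dec_; _→-dec_)

-- All vectors with entries drawn from xs; without repetitions if xs has none.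
vectors : ∀ {A : Set} → List A → (n : ℕ) → List (Vec A n)
vectors xs zero    = Vec.[] ∷ []
vectors xs (suc n) = cartesianProductWith Vec._∷_ xs (vectors xs n)

-- All sublists of xs. When xs has no repetitions these represent the subsets
-- of its set of entries, each exactly once.
sublists : ∀ {A : Set} → List A → List (List A)
sublists []       = [] ∷ []
sublists (x ∷ xs) = sublists xs ++ map (x ∷_) (sublists xs)

-- A map σ from Fin r to itself is represented by its vector of values.
IsPermutation : ∀ {r} → Vec (Fin r) r → Set
IsPermutation σ = Bijective _≡_ _≡_ (lookup σ)

IsDerangement : ∀ {r} → Vec (Fin r) r → Set
IsDerangement σ = IsPermutation σ × (∀ i → lookup σ i ≢ i)

isPermutation? : ∀ {r} (σ : Vec (Fin r) r) → Dec (IsPermutation σ)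
isPermutation? σ =
  map′ (λ inj {x} {y} → inj x y) (λ inj x y → inj {x} {y})
    (all? λ x → all? λ y → (lookup σ x ≟ lookup σ y) →-dec (x ≟ y))
  ×-dec
  all? λ y → map′ (λ { (x , eq) → x , λ { refl → eq } }) (λ { (x , eq) → x , eq refl })
    (any? λ x → lookup σ x ≟ y)

isDerangement? : ∀ {r} (σ : Vec (Fin r) r) → Dec (IsDerangement σ)
isDerangement? σ = isPermutation? σ ×-dec all? λ i → ¬? (lookup σ i ≟ i)

d : ℕ → ℕ
d r = length (filter isDerangement? (vectors (allFin r) r))

subsets : (i : ℕ) → List (Subset i)
subsets = vectors (outside ∷ inside ∷ [])

record IsPartition {i : ℕ} (P : List (Subset i)) : Set where
  constructor mkIsPartition
  field
    nonempty : All Nonempty P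
    disjoint : AllPairs (λ p q → Empty (p ∩ q)) P
    covering : ∀ x → Any (x ∈_) P

isPartition? : ∀ {i} (P : List (Subset i)) → Dec (IsPartition P)
isPartition? P =
  map′ (λ { (n , dj , c) → mkIsPartition n dj c })
       (λ { (mkIsPartition n dj c) → n , dj , c })
    (All.all? nonempty? P
     ×-dec AllPairs.allPairs? (λ p q → ¬? (nonempty? (p ∩ q))) P
     ×-dec all? λ x → Any.any? (x ∈?_) P)

-- Families of subsets of Fin i are the sublists of subsets i.
B : ℕ → ℕ
B i = length (filter isPartition? (sublists (subsets i)))

-- A polynomial a_m x^m + … + a_1 x + a_0 is given by its coefficients (a_0, …, a_m);
-- a_m is allowed to be zero.
eval : ∀ {m} → Vector ℤ (suc m) → ℤ → ℤ
eval {m} a x = ∑[ i ≤ m ] (a i * x ^ toℕ i)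

{-# OPTIONS --safe #-}
module Submission where

-- Put Φ(g) = Σₖ g(k) C(n,k) d(n−k) and let (k)_j be the falling factorial. Absorbing the factors
-- of (k)_j into C(n,k) reduces Φ((k)_j) = n! (for j ≤ n) to Σₖ C(n,k) d(n−k) = n!. Then
-- k (k)_j = j (k)_j + (k)_{j+1} gives Φ(kⁱ (k)_j) = β(i,j) n! whenever i + j ≤ n, where β(0,j) = 1
-- and β(i+1,j) = j β(i,j) + β(i,j+1).
--
-- To see that β(i,0) = B i, weight each family of disjoint nonempty blocks in an i-set by j^r, where
-- r is the number of uncovered points; the total weight is β(i,j). Indeed, the first point is either
-- uncovered, which gives j β(i,j), or forms a block together with a subset x of the r points left
-- uncovered by the other blocks, and the sum of j^(r−|x|) over all x is (j+1)^r. For j = 0 only the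
-- partitions have nonzero weight.
--
-- The derangement identity follows from the numbers E(n,t) of permutations of n points whose fixed
-- points are all among the first t: E(n+1,t+1) = E(n+1,t) + E(n,t), E(n,0) = d n, E(n,n) = n!.

open import Defs
import Algebra.Properties.Semiring.Sum as SemiringSum
open import Data.Bool using (true; false; if_then_else_)
open import Data.Fin using (Fin; toℕ; zero; suc; punchIn; punchOut; fromℕ<; _≟_)
open import Data.Fin.Properties using (all?; any?; punchIn-injective; punchInᵢ≢i; punchOut-injective; punchIn-punchOut; toℕ-fromℕ<; toℕ-injective; toℕ<n; toℕ≤pred[n]; injective⇒≤)
open import Data.Fin.Subset using (Subset; inside; outside; Nonempty; Empty; ⊤; ∣_∣; ∁; _⊆_; _∩_) renaming (_∈_ to _∈ₛ_)
open import Data.Fin.Subset.Properties using (nonempty?; _⊆?_; _∈?_; ∈⊤; out⊆; in⊆in; out⊆-⇔; in⊆in-⇔; drop-∷-⊆; p∩q⊆q; x∈∁p⇒x∉p; x∉p⇒x∈∁p; x∈p∩q⁺; x∈p∩q⁻)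
open import Data.Integer as ℤ using (ℤ; +_; _*_)
import Data.Integer.Properties as ℤₚ
open import Data.List using (List; []; _∷_; _++_; length; filter; map; allFin; cartesianProductWith)
open import Data.List.Membership.Propositional using (_∈_)
open import Data.List.Membership.Propositional.Properties using (∈-filter⁺; ∈-filter⁻; ∈-map⁺; ∈-map⁻; ∈-allFin; ∈-cartesianProductWith⁺; ∈-cartesianProductWith⁻)
open import Data.List.Membership.Propositional.Properties.WithK using (unique∧set⇒bag)
open import Data.List.Properties using (length-map; length-++; length-tabulate; filter-++; filter-≐; ++-identityʳ)
open import Data.List.Relation.Binary.BagAndSetEquality using (∼bag⇒↭)
open import Data.List.Relation.Binary.Permutation.Propositional.Properties using (↭-length)
open import Data.List.Relation.Unary.All as All using (All; []; _∷_)
open import Data.List.Relation.Unary.AllPairs using (AllPairs; []; _∷_)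
open import Data.List.Relation.Unary.Any using (Any; here; there)
open import Data.List.Relation.Unary.Unique.Propositional using (Unique)
import Data.List.Relation.Unary.Unique.Propositional.Properties as Unique
open import Data.Nat using (ℕ; zero; suc; _+_; _≤_; _<_; _≥_; _∸_; _^_; _!; _≤?_; z≤n; s≤s) renaming (_*_ to _·_)
open import Data.Nat.Combinatorics using (_C_; nCk+nC[k+1]≡[n+1]C[k+1]; nC1≡n; nCn≡1; nCk≡nC[n∸k]; k>n⇒nCk≡0)
import Data.Nat.Properties as ℕₚ
open import Data.Nat.Tactic.RingSolver using (solve-∀)
open import Data.Product using (_×_; _,_; proj₁; proj₂; ∃)
open import Data.Sum using (_⊎_; inj₁; inj₂)
open import Data.Vec as Vec using (Vec; lookup; insertAt; tabulate)
open import Data.Vec.Functional using (Vector)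
open import Data.Vec.Properties using (∷-injective; insertAt-lookup; insertAt-punchIn; lookup-map; lookup∘tabulate; tabulate∘lookup; tabulate-cong)
open import Function using (_∘_; _⇔_; mk⇔)
open import Function.Definitions using (Injective)
open import Relation.Binary.PropositionalEquality using (_≡_; _≢_; _≗_; refl; sym; trans; cong; cong₂; subst; module ≡-Reasoning)
open import Relation.Nullary using (yes; no; ¬_; ¬?; does; contradiction)
open import Relation.Nullary.Decidable using (_×-dec_; _→-dec_; does-⇔; dec-false)
open import Relation.Unary using (Decidable)

module Σℕ = SemiringSum ℕₚ.+-*-semiring
module Σℤ = SemiringSum ℤₚ.+-*-semiring

-- Permutations and derangements

length-cartesianProductWith : ∀ {A B C : Set} (f : A → B → C) xs ys →
  length (cartesianProductWith f xs ys) ≡ length xs · length ys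
length-cartesianProductWith f []       ys = refl
length-cartesianProductWith f (x ∷ xs) ys = trans
  (length-++ (map (f x) ys))
  (cong₂ _+_ (length-map (f x) ys) (length-cartesianProductWith f xs ys))

length-filter-split : ∀ {A : Set} {P Q : A → Set} (P? : Decidable P) (Q? : Decidable Q) xs →
  length (filter P? xs) ≡
  length (filter (λ x → P? x ×-dec ¬? (Q? x)) xs) + length (filter (λ x → P? x ×-dec Q? x) xs)
length-filter-split P? Q? []       = refl
length-filter-split P? Q? (x ∷ xs) with ih ← length-filter-split P? Q? xs | P? x | Q? x
... | yes _ | yes _ = trans (cong suc ih) (sym (ℕₚ.+-suc _ _))
... | yes _ | no  _ = cong suc ih
... | no  _ | _     = ih

-- On repetition-free lists set equality is bag equality, and bag-equal lists are permutations of
-- each other. A count can thus be read off any repetition-free enumeration.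
unique-length : ∀ {A : Set} {xs ys : List A} → Unique xs → Unique ys →
  (∀ {x} → x ∈ xs ⇔ x ∈ ys) → length xs ≡ length ys
unique-length xs! ys! same = ↭-length (∼bag⇒↭ (unique∧set⇒bag xs! ys! same))

vectors-unique : ∀ {A : Set} {xs : List A} → Unique xs → ∀ n → Unique (vectors xs n)
vectors-unique xs! zero    = [] ∷ []
vectors-unique xs! (suc n) =
  Unique.cartesianProductWith⁺ Vec._∷_ ∷-injective xs! (vectors-unique xs! n)

∈-vectors : ∀ {m n} (v : Vec (Fin m) n) → v ∈ vectors (allFin m) n
∈-vectors Vec.[]      = here refl
∈-vectors (x Vec.∷ v) = ∈-cartesianProductWith⁺ Vec._∷_ (∈-allFin x) (∈-vectors v)

selfMaps : ∀ n → List (Vec (Fin n) n)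
selfMaps n = vectors (allFin n) n

count : ∀ n {P : Vec (Fin n) n → Set} → Decidable P → ℕ
count n P? = length (filter P? (selfMaps n))

selected-unique : ∀ {n} {P : Vec (Fin n) n → Set} (P? : Decidable P) → Unique (filter P? (selfMaps n))
selected-unique {n} P? = Unique.filter⁺ P? (vectors-unique (Unique.allFin⁺ n) n)

length-enumeration : ∀ {n} {P : Vec (Fin n) n → Set} (P? : Decidable P) {xs} → Unique xs →
  (∀ σ → σ ∈ xs → P σ) → (∀ σ → P σ → σ ∈ xs) → count n P? ≡ length xs
length-enumeration {n} P? xs! sound complete = unique-length (selected-unique P?) xs! λ {σ} → mk⇔
  (λ σ∈ → complete σ (proj₂ (∈-filter⁻ P? {xs = selfMaps n} σ∈)))
  (λ σ∈ → ∈-filter⁺ P? (∈-vectors σ) (sound σ σ∈))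

count-≐ : ∀ {n} {P Q : Vec (Fin n) n → Set} (P? : Decidable P) (Q? : Decidable Q) →
  (∀ σ → P σ → Q σ) → (∀ σ → Q σ → P σ) → count n P? ≡ count n Q?
count-≐ {n} P? Q? to from =
  cong length (filter-≐ P? Q? ((λ {σ} → to σ) , (λ {σ} → from σ)) (selfMaps n))

lookup-ext : ∀ {A : Set} {n} {u v : Vec A n} → (∀ i → lookup u i ≡ lookup v i) → u ≡ v
lookup-ext {u = u} {v} eq =
  trans (sym (tabulate∘lookup u)) (trans (tabulate-cong eq) (tabulate∘lookup v))

-- Pigeonhole: if `y` were missed, `punchOut` at `y` would inject `Fin (suc n)` into `Fin n`.
injective⇒permutation : ∀ {n} (σ : Vec (Fin n) n) → Injective _≡_ _≡_ (lookup σ) → IsPermutation σ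
injective⇒permutation σ inj = inj , surj σ inj
  where
  surj : ∀ {n} (σ : Vec (Fin n) n) → Injective _≡_ _≡_ (lookup σ) →
         ∀ y → ∃ λ x → ∀ {z} → z ≡ x → lookup σ z ≡ y
  surj {suc n} σ inj y with any? (λ x → lookup σ x ≟ y)
  ... | yes (x , eq) = x , λ { refl → eq }
  ... | no  ¬hit     = contradiction
    (injective⇒≤ {f = λ x → punchOut {i = y} (λ eq → ¬hit (x , sym eq))}
      (λ {x} {z} eq → inj (punchOut-injective (λ eq → ¬hit (x , sym eq)) (λ eq → ¬hit (z , sym eq)) eq)))
    ℕₚ.1+n≰n

punchIn-cover : ∀ {n} (i k : Fin (suc n)) → k ≡ i ⊎ ∃ λ j → k ≡ punchIn i j
punchIn-cover i k with i ≟ k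
... | yes i≡k = inj₁ (sym i≡k)
... | no  i≢k = inj₂ (punchOut i≢k , sym (punchIn-punchOut i≢k))

-- Sends `i` to `v` and acts elsewhere as `τ`, once `i` is deleted from the positions and `v` from
-- the values. Two counts use it: `i = zero` with any `v` for all permutations, and `v = i` for
-- those fixing `i`.
extend : ∀ {n} → Fin (suc n) → Fin (suc n) → Vec (Fin n) n → Vec (Fin (suc n)) (suc n)
extend i v τ = insertAt (Vec.map (punchIn v) τ) i v

module _ {n} (i v : Fin (suc n)) (τ : Vec (Fin n) n) where

  extend-at : lookup (extend i v τ) i ≡ v
  extend-at = insertAt-lookup (Vec.map (punchIn v) τ) i v

  extend-off : ∀ j → lookup (extend i v τ) (punchIn i j) ≡ punchIn v (lookup τ j)
  extend-off j = trans (insertAt-punchIn (Vec.map (punchIn v) τ) i v j) (lookup-map j (punchIn v) τ)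

extend-injective : ∀ {n} i {v w : Fin (suc n)} {τ ρ} → extend i v τ ≡ extend i w ρ → v ≡ w × τ ≡ ρ
extend-injective i {v} {w} {τ} {ρ} eq
  with refl ← trans (sym (extend-at i v τ)) (trans (cong (λ σ → lookup σ i) eq) (extend-at i w ρ))
  = refl , lookup-ext (λ j → punchIn-injective v _ _
      (trans (sym (extend-off i v τ j)) (trans (cong (λ σ → lookup σ (punchIn i j)) eq) (extend-off i v ρ j))))

-- The value `v` is taken only at `i`, because `punchIn v` avoids `v`; elsewhere injectivity is
-- inherited from `τ`.
extend-permutation : ∀ {n} i (v : Fin (suc n)) {τ} → IsPermutation τ → IsPermutation (extend i v τ)
extend-permutation i v {τ} (inj , _) = injective⇒permutation (extend i v τ) λ {x} {y} → helper x y
  where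
  helper : ∀ x y → lookup (extend i v τ) x ≡ lookup (extend i v τ) y → x ≡ y
  helper x y eq with punchIn-cover i x | punchIn-cover i y
  ... | inj₁ refl       | inj₁ refl       = refl
  ... | inj₁ refl       | inj₂ (k , refl) = contradiction
    (trans (sym (extend-off i v τ k)) (trans (sym eq) (extend-at i v τ))) (punchInᵢ≢i v _)
  ... | inj₂ (j , refl) | inj₁ refl       = contradiction
    (trans (sym (extend-off i v τ j)) (trans eq (extend-at i v τ))) (punchInᵢ≢i v _)
  ... | inj₂ (j , refl) | inj₂ (k , refl) = cong (punchIn i) (inj (punchIn-injective v _ _
    (trans (sym (extend-off i v τ j)) (trans eq (extend-off i v τ k)))))

-- Position `i` and its value are deleted: by injectivity all other values differ from `lookup σ i`,
-- so `punchOut` applies to them.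
extend-surjective : ∀ {n} i {σ : Vec (Fin (suc n)) (suc n)} → IsPermutation σ →
  ∃ λ τ → IsPermutation τ × σ ≡ extend i (lookup σ i) τ
extend-surjective {n} i {σ} (inj , _) = τ , injective⇒permutation τ τ-inj , lookup-ext agree
  where
  σi≢ : ∀ j → lookup σ i ≢ lookup σ (punchIn i j)
  σi≢ j eq = punchInᵢ≢i i j (sym (inj eq))
  τ : Vec (Fin n) n
  τ = tabulate (λ j → punchOut (σi≢ j))
  lookup-τ : ∀ j → lookup τ j ≡ punchOut (σi≢ j)
  lookup-τ = lookup∘tabulate _
  τ-inj : Injective _≡_ _≡_ (lookup τ)
  τ-inj {j} {k} eq = punchIn-injective i j k (inj (punchOut-injective (σi≢ j) (σi≢ k)
    (trans (sym (lookup-τ j)) (trans eq (lookup-τ k)))))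
  agree : ∀ k → lookup σ k ≡ lookup (extend i (lookup σ i) τ) k
  agree k with punchIn-cover i k
  ... | inj₁ refl       = sym (extend-at i _ τ)
  ... | inj₂ (j , refl) = sym (trans (extend-off i _ τ j)
    (trans (cong (punchIn _) (lookup-τ j)) (punchIn-punchOut (σi≢ j))))

-- The image of `zero` is arbitrary and the rest is a permutation of `n` points, whence the factor
-- `suc n`.
count-permutations : ∀ n → count n isPermutation? ≡ n !
count-permutations zero    = refl
count-permutations (suc n) = begin
  count (suc n) isPermutation?
    ≡⟨ length-enumeration isPermutation?
         (Unique.cartesianProductWith⁺ (extend zero) (extend-injective zero)
           (Unique.allFin⁺ (suc n)) (selected-unique isPermutation?))
         sound complete ⟩
  length (cartesianProductWith (extend zero) (allFin (suc n)) perms)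
    ≡⟨ length-cartesianProductWith (extend zero) (allFin (suc n)) perms ⟩
  length (allFin (suc n)) · count n isPermutation?
    ≡⟨ cong₂ _·_ (length-tabulate {n = suc n} (λ i → i)) (count-permutations n) ⟩
  suc n · n ! ∎
  where
  open ≡-Reasoning
  perms = filter isPermutation? (selfMaps n)
  sound : ∀ σ → σ ∈ cartesianProductWith (extend zero) (allFin (suc n)) perms → IsPermutation σ
  sound σ σ∈ with v , τ , _ , τ∈ , refl ← ∈-cartesianProductWith⁻ (extend zero) (allFin (suc n)) perms σ∈
    = extend-permutation zero v (proj₂ (∈-filter⁻ isPermutation? {xs = selfMaps n} τ∈))
  complete : ∀ σ → IsPermutation σ → σ ∈ cartesianProductWith (extend zero) (allFin (suc n)) perms
  complete σ σ-perm with τ , τ-perm , eq ← extend-surjective zero {σ} σ-perm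
    = subst (_∈ cartesianProductWith (extend zero) (allFin (suc n)) perms) (sym eq)
        (∈-cartesianProductWith⁺ (extend zero) (∈-allFin _)
          (∈-filter⁺ isPermutation? (∈-vectors τ) τ-perm))

-- Permutations with restricted fixed points

-- Counting these gives E(n,t), which runs from derangements at `t = 0` to all permutations at
-- `t = n`.
DerangedFrom : ∀ {n} → ℕ → Vec (Fin n) n → Set
DerangedFrom t σ = IsPermutation σ × (∀ i → t ≤ toℕ i → lookup σ i ≢ i)

derangedFrom? : ∀ {n} t → Decidable (DerangedFrom {n} t)
derangedFrom? t σ = isPermutation? σ ×-dec all? λ i → (t ≤? toℕ i) →-dec ¬? (lookup σ i ≟ i)

derangedFrom-zero : ∀ n → count n (derangedFrom? 0) ≡ d n
derangedFrom-zero n = count-≐ {n} (derangedFrom? 0) isDerangement?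
  (λ σ (perm , free) → perm , λ i → free i z≤n) (λ σ (perm , free) → perm , λ i _ → free i)

derangedFrom-all : ∀ n → count n (derangedFrom? n) ≡ n !
derangedFrom-all n = trans
  (count-≐ (derangedFrom? n) isPermutation? (λ σ → proj₁)
    (λ σ perm → perm , λ i n≤i → contradiction n≤i (ℕₚ.<⇒≱ (toℕ<n i))))
  (count-permutations n)

-- Deleting position `i` moves every later position down by one, so the threshold `suc (toℕ i)`
-- before deletion becomes `toℕ i` after it.
≤⇒<punchIn : ∀ {n} (i : Fin (suc n)) (j : Fin n) → toℕ i ≤ toℕ j → toℕ i < toℕ (punchIn i j)
≤⇒<punchIn zero    j       _         = s≤s z≤n
≤⇒<punchIn (suc i) (suc j) (s≤s i≤j) = s≤s (≤⇒<punchIn i j i≤j)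

<punchIn⇒≤ : ∀ {n} (i : Fin (suc n)) (j : Fin n) → toℕ i < toℕ (punchIn i j) → toℕ i ≤ toℕ j
<punchIn⇒≤ zero    j       _         = z≤n
<punchIn⇒≤ (suc i) (suc j) (s≤s i<j) = s≤s (<punchIn⇒≤ i j i<j)

-- A permutation free of fixed points beyond i either also moves i, or fixes it and is an
-- extension of a permutation of the remaining points.
derangedFrom-split : ∀ {n} (i : Fin (suc n)) →
  count (suc n) (derangedFrom? (suc (toℕ i))) ≡
  count (suc n) (derangedFrom? (toℕ i)) + count n (derangedFrom? (toℕ i))
derangedFrom-split {n} i = begin
  count (suc n) (derangedFrom? (suc t))
    ≡⟨ length-filter-split (derangedFrom? (suc t)) fixes? (selfMaps (suc n)) ⟩
  count (suc n) (λ σ → derangedFrom? (suc t) σ ×-dec ¬? (fixes? σ)) +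
  count (suc n) (λ σ → derangedFrom? (suc t) σ ×-dec fixes? σ)
    ≡⟨ cong₂ _+_
         (count-≐ _ (derangedFrom? t) to from)
         (length-enumeration _
           (Unique.map⁺ (proj₂ ∘ extend-injective i) (selected-unique (derangedFrom? t)))
           sound complete) ⟩
  count (suc n) (derangedFrom? t) + length (map (extend i i) (filter (derangedFrom? t) (selfMaps n)))
    ≡⟨ cong (λ m → count (suc n) (derangedFrom? t) + m) (length-map (extend i i) (filter (derangedFrom? t) (selfMaps n))) ⟩
  count (suc n) (derangedFrom? t) + count n (derangedFrom? t) ∎
  where
  open ≡-Reasoning
  t = toℕ i
  fixes? : Decidable (λ (σ : Vec (Fin (suc n)) (suc n)) → lookup σ i ≡ i)
  fixes? σ = lookup σ i ≟ i
  to : ∀ σ → DerangedFrom (suc t) σ × lookup σ i ≢ i → DerangedFrom t σ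
  to σ ((perm , free) , moves) = perm , free′
    where
    free′ : ∀ k → t ≤ toℕ k → lookup σ k ≢ k
    free′ k t≤k with i ≟ k
    ... | yes refl = moves
    ... | no  i≢k  = free k (ℕₚ.≤∧≢⇒< t≤k (i≢k ∘ toℕ-injective))
  from : ∀ σ → DerangedFrom t σ → DerangedFrom (suc t) σ × lookup σ i ≢ i
  from σ (perm , free) = (perm , λ k t<k → free k (ℕₚ.<⇒≤ t<k)) , free i ℕₚ.≤-refl
  sound : ∀ σ → σ ∈ map (extend i i) (filter (derangedFrom? t) (selfMaps n)) →
          DerangedFrom (suc t) σ × lookup σ i ≡ i
  sound σ σ∈ with τ , τ∈ , refl ← ∈-map⁻ (extend i i) σ∈
           with _ , perm , free ← ∈-filter⁻ (derangedFrom? t) {xs = selfMaps n} τ∈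
    = (extend-permutation i i perm , free′) , extend-at i i τ
    where
    free′ : ∀ k → t < toℕ k → lookup (extend i i τ) k ≢ k
    free′ k t<k eq with punchIn-cover i k
    ... | inj₁ refl       = ℕₚ.<-irrefl refl t<k
    ... | inj₂ (j , refl) = free j (<punchIn⇒≤ i j t<k)
      (punchIn-injective i _ _ (trans (sym (extend-off i i τ j)) eq))
  complete : ∀ σ → DerangedFrom (suc t) σ × lookup σ i ≡ i →
             σ ∈ map (extend i i) (filter (derangedFrom? t) (selfMaps n))
  complete σ ((perm , free) , fixed) with τ , τ-perm , eq ← extend-surjective i {σ} perm
    = subst (_∈ map (extend i i) (filter (derangedFrom? t) (selfMaps n))) (sym σ≡)
        (∈-map⁺ (extend i i) (∈-filter⁺ (derangedFrom? t) (∈-vectors τ) (τ-perm , free′)))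
    where
    σ≡ : σ ≡ extend i i τ
    σ≡ = trans eq (cong (λ v → extend i v τ) fixed)
    free′ : ∀ j → t ≤ toℕ j → lookup τ j ≢ j
    free′ j t≤j τj≡j = free (punchIn i j) (≤⇒<punchIn i j t≤j)
      (trans (cong (λ ρ → lookup ρ (punchIn i j)) σ≡)
        (trans (extend-off i i τ j) (cong (punchIn i) τj≡j)))

-- Set partitions

-- These are the r-Bell numbers with r = `j`: partitions of `i + j` points in which `j` marked
-- points lie in distinct blocks.
β : ℕ → ℕ → ℕ
β zero    j = 1
β (suc i) j = j · β i j + β i (suc j)

infixl 5 _∖_

-- Data.Fin.Subset._─_ does not compute on _∷_, this form does.
_∖_ : ∀ {n} → Subset n → Subset n → Subset n
q ∖ x = ∁ x ∩ q

∖⊆ : ∀ {n} (q x : Subset n) → q ∖ x ⊆ q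
∖⊆ q x = p∩q⊆q (∁ x) q

∈∖⇒∉ : ∀ {n} (q x : Subset n) {y} → y ∈ₛ q ∖ x → ¬ y ∈ₛ x
∈∖⇒∉ q x y∈ = x∈∁p⇒x∉p (proj₁ (x∈p∩q⁻ (∁ x) q y∈))

∈∖ : ∀ {n} {q x : Subset n} {y} → y ∈ₛ q → ¬ y ∈ₛ x → y ∈ₛ q ∖ x
∈∖ y∈q y∉x = x∈p∩q⁺ (x∉p⇒x∈∁p y∉x , y∈q)

Block : ∀ {n} → Subset n → Subset n → Set
Block q x = Nonempty x × x ⊆ q

block? : ∀ {n} (q : Subset n) → Decidable (Block q)
block? q x = nonempty? x ×-dec (x ⊆? q)

-- Being a partition, phrased as removing the blocks one after another until nothing is left. This
-- form recurses on the list, as `sublists` does.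
Fits : ∀ {n} → Subset n → List (Subset n) → Set
Fits q []      = ∣ q ∣ ≡ 0
Fits q (x ∷ P) = Block q x × Fits (q ∖ x) P

fits? : ∀ {n} (q : Subset n) → Decidable (Fits q)
fits? q []      = ∣ q ∣ ℕₚ.≟ 0
fits? q (x ∷ P) = block? q x ×-dec fits? (q ∖ x) P

∣∣≡0⇒∉ : ∀ {n} (q : Subset n) → ∣ q ∣ ≡ 0 → ∀ {y} → ¬ y ∈ₛ q
∣∣≡0⇒∉ (outside Vec.∷ q) eq (Vec.there y∈) = ∣∣≡0⇒∉ q eq y∈

∉⇒∣∣≡0 : ∀ {n} (q : Subset n) → (∀ y → ¬ y ∈ₛ q) → ∣ q ∣ ≡ 0
∉⇒∣∣≡0 Vec.[]            _     = refl
∉⇒∣∣≡0 (outside Vec.∷ q) empty = ∉⇒∣∣≡0 q (λ y y∈ → empty (suc y) (Vec.there y∈))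
∉⇒∣∣≡0 (inside  Vec.∷ q) empty = contradiction Vec.here (empty zero)

-- `IsPartition` relative to `q`, so that the induction can pass from `q` to what remains after the
-- first block.
record PartitionOf {n} (q : Subset n) (P : List (Subset n)) : Set where
  constructor mkPartitionOf
  field
    nonempty : All Nonempty P
    disjoint : AllPairs (λ p r → Empty (p ∩ r)) P
    within   : All (_⊆ q) P
    covering : ∀ {y} → y ∈ₛ q → Any (y ∈ₛ_) P

-- Blocks within `q ∖ x` are disjoint from `x`, and a point of `q` lies in `x` or is covered by the
-- later blocks.
fits⇒partitionOf : ∀ {n} (q : Subset n) P → Fits q P → PartitionOf q P
fits⇒partitionOf q []      ∣q∣≡0 = mkPartitionOf [] [] [] (λ y∈q → contradiction y∈q (∣∣≡0⇒∉ q ∣q∣≡0))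
fits⇒partitionOf q (x ∷ P) ((x≠∅ , x⊆q) , fits)
  with mkPartitionOf ne dj wi co ← fits⇒partitionOf (q ∖ x) P fits
  = mkPartitionOf (x≠∅ ∷ ne)
      (All.map (λ {p} p⊆ (y , y∈) → let y∈x , y∈p = x∈p∩q⁻ x p y∈ in ∈∖⇒∉ q x (p⊆ y∈p) y∈x) wi ∷ dj)
      ((λ {y} → x⊆q {y}) ∷ All.map (λ p⊆ {y} y∈p → ∖⊆ q x (p⊆ y∈p)) wi)
      cover
  where
  cover : ∀ {y} → y ∈ₛ q → Any (y ∈ₛ_) (x ∷ P)
  cover {y} y∈q with y ∈? x
  ... | yes y∈x = here y∈x
  ... | no  y∉x = there (co (∈∖ y∈q y∉x))

-- Later blocks are disjoint from `x`, hence lie within `q ∖ x`, and a point of `q ∖ x` can only be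
-- covered by one of them.
partitionOf⇒fits : ∀ {n} (q : Subset n) P → PartitionOf q P → Fits q P
partitionOf⇒fits q []      (mkPartitionOf _ _ _ co) = ∉⇒∣∣≡0 q (λ y y∈q → case-[] (co y∈q))
  where
  case-[] : ∀ {y} → ¬ Any (y ∈ₛ_) []
  case-[] ()
partitionOf⇒fits q (x ∷ P) (mkPartitionOf (x≠∅ ∷ ne) (dx ∷ dj) (x⊆q ∷ wi) co) =
  (x≠∅ , λ {y} → x⊆q {y}) , partitionOf⇒fits (q ∖ x) P (mkPartitionOf ne dj
    (All.zipWith (λ {p} (disj , p⊆q) {y} y∈p →
       ∈∖ (p⊆q y∈p) (λ y∈x → disj (y , x∈p∩q⁺ (y∈x , y∈p)))) (dx , wi))
    (λ {y} y∈ → uncover (∈∖⇒∉ q x y∈) (co (∖⊆ q x y∈))))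
  where
  uncover : ∀ {y} → ¬ y ∈ₛ x → Any (y ∈ₛ_) (x ∷ P) → Any (y ∈ₛ_) P
  uncover y∉x (here y∈x) = contradiction y∈x y∉x
  uncover y∉x (there y∈) = y∈

isPartition⇒fits : ∀ {n} {P : List (Subset n)} → IsPartition P → Fits ⊤ P
isPartition⇒fits {P = P} (mkIsPartition ne dj co) =
  partitionOf⇒fits ⊤ P (mkPartitionOf ne dj (All.universal (λ _ {_} _ → ∈⊤) P) (λ {y} _ → co y))

fits⇒isPartition : ∀ {n} {P : List (Subset n)} → Fits ⊤ P → IsPartition P
fits⇒isPartition {P = P} fits with mkPartitionOf ne dj _ co ← fits⇒partitionOf ⊤ P fits
  = mkIsPartition ne dj (λ y → co ∈⊤)

-- The sum of K over the sets that remain when disjoint nonempty blocks from xs are removed from q.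
packings : ∀ {n} → List (Subset n) → Subset n → (Subset n → ℕ) → ℕ
packings []       q K = K q
packings (x ∷ xs) q K =
  packings xs q K + (if does (block? q x) then packings xs (q ∖ x) K else 0)

-- At `j = 0` this is the indicator of the empty set, since `0 ^ 0` is 1. Larger `j` arise because
-- splitting off a point raises `j`.
vacant : ∀ {n} → ℕ → Subset n → ℕ
vacant j q = j ^ ∣ q ∣

length-filter-fits-∷ : ∀ {n} (q x : Subset n) Ps →
  length (filter (fits? q) (map (x ∷_) Ps)) ≡
  (if does (block? q x) then length (filter (fits? (q ∖ x)) Ps) else 0)
length-filter-fits-∷ q x [] with does (block? q x)
... | true  = refl
... | false = refl
length-filter-fits-∷ q x (P ∷ Ps) with ih ← length-filter-fits-∷ q x Ps | does (block? q x)
... | false = ih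
... | true  with does (fits? (q ∖ x) P)
...   | true  = cong suc ih
...   | false = ih

-- Both sides split by whether the family contains `x`; at the end `vacant 0` tests whether
-- everything is covered.
count-fits : ∀ {n} xs (q : Subset n) → length (filter (fits? q) (sublists xs)) ≡ packings xs q (vacant 0)
count-fits []       q with ∣ q ∣
... | zero  = refl
... | suc _ = refl
count-fits (x ∷ xs) q = begin
  length (filter (fits? q) (sublists xs ++ map (x ∷_) (sublists xs)))
    ≡⟨ cong length (filter-++ (fits? q) (sublists xs) _) ⟩
  length (filter (fits? q) (sublists xs) ++ filter (fits? q) (map (x ∷_) (sublists xs)))
    ≡⟨ length-++ (filter (fits? q) (sublists xs)) ⟩
  length (filter (fits? q) (sublists xs)) + length (filter (fits? q) (map (x ∷_) (sublists xs)))
    ≡⟨ cong₂ _+_ (count-fits xs q)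
         (trans (length-filter-fits-∷ q x (sublists xs))
           (cong (λ m → if does (block? q x) then m else 0) (count-fits xs (q ∖ x)))) ⟩
  packings (x ∷ xs) q (vacant 0) ∎
  where open ≡-Reasoning

packings-cong : ∀ {n} xs (q : Subset n) {K L} → K ≗ L → packings xs q K ≡ packings xs q L
packings-cong []       q K≗L = K≗L q
packings-cong (x ∷ xs) q K≗L = cong₂ (λ a b → a + (if does (block? q x) then b else 0))
  (packings-cong xs q K≗L) (packings-cong xs (q ∖ x) K≗L)

packings-linear : ∀ {n} xs (q : Subset n) c K L →
  packings xs q (λ r → c · K r + L r) ≡ c · packings xs q K + packings xs q L
packings-linear []       q c K L = refl
packings-linear (x ∷ xs) q c K L
  rewrite packings-linear xs q c K L | packings-linear xs (q ∖ x) c K L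
  with does (block? q x)
... | true  = rearrange c _ _ _ _
  where
  rearrange : ∀ c k l k′ l′ → c · k + l + (c · k′ + l′) ≡ c · (k + k′) + (l + l′)
  rearrange = solve-∀
... | false = rearrange c _ _
  where
  rearrange : ∀ c k l → c · k + l + 0 ≡ c · (k + 0) + (l + 0)
  rearrange = solve-∀

-- Blocks from `xs` are removed first, then blocks from `ys` out of what remains. It will separate
-- the sets avoiding the first point from those through it.
packings-++ : ∀ {n} xs ys (q : Subset n) K →
  packings (xs ++ ys) q K ≡ packings xs q (λ r → packings ys r K)
packings-++ []       ys q K = refl
packings-++ (x ∷ xs) ys q K = cong₂ (λ a b → a + (if does (block? q x) then b else 0))
  (packings-++ xs ys q K) (packings-++ xs ys (q ∖ x) K)

-- Splitting packings at the first point

block-outside : ∀ {n s} (q x : Subset n) →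
  does (block? (s Vec.∷ q) (outside Vec.∷ x)) ≡ does (block? q x)
block-outside {s = s} q x = does-⇔ (mk⇔ shrink grow) (block? (s Vec.∷ q) (outside Vec.∷ x)) (block? q x)
  where
  shrink : Block (s Vec.∷ q) (outside Vec.∷ x) → Block q x
  shrink ((zero  , ()) , _)
  shrink ((suc y , Vec.there y∈x) , x⊆q) = (y , y∈x) , drop-∷-⊆ x⊆q
  grow : Block q x → Block (s Vec.∷ q) (outside Vec.∷ x)
  grow ((y , y∈x) , x⊆q) = (suc y , Vec.there y∈x) , out⊆ x⊆q

block-inside : ∀ {n} (q x : Subset n) →
  does (block? (inside Vec.∷ q) (inside Vec.∷ x)) ≡ does (x ⊆? q)
block-inside q x = does-⇔ (mk⇔ shrink grow) (block? (inside Vec.∷ q) (inside Vec.∷ x)) (x ⊆? q)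
  where
  shrink : Block (inside Vec.∷ q) (inside Vec.∷ x) → x ⊆ q
  shrink (_ , x⊆q) = drop-∷-⊆ x⊆q
  grow : x ⊆ q → Block (inside Vec.∷ q) (inside Vec.∷ x)
  grow x⊆q = (zero , Vec.here) , in⊆in x⊆q

block-inside-outside : ∀ {n} (q x : Subset n) →
  does (block? (outside Vec.∷ q) (inside Vec.∷ x)) ≡ false
block-inside-outside q x = dec-false (block? (outside Vec.∷ q) (inside Vec.∷ x))
  λ (_ , x⊆q) → case-here (x⊆q Vec.here)
  where
  case-here : ¬ zero ∈ₛ outside Vec.∷ q
  case-here ()

packings-outside : ∀ {n} xs s (q : Subset n) K →
  packings (map (outside Vec.∷_) xs) (s Vec.∷ q) K ≡ packings xs q (λ r → K (s Vec.∷ r))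
packings-outside []       s q K = refl
packings-outside (x ∷ xs) s q K
  rewrite block-outside {s = s} q x | packings-outside xs s q K | packings-outside xs s (q ∖ x) K
  = refl

-- The first point is already gone, so no set through it is a block of what remains.
packings-inside-outside : ∀ {n} xs (q : Subset n) K →
  packings (map (inside Vec.∷_) xs) (outside Vec.∷ q) K ≡ K (outside Vec.∷ q)
packings-inside-outside []       q K = refl
packings-inside-outside (x ∷ xs) q K
  rewrite block-inside-outside q x | packings-inside-outside xs q K = ℕₚ.+-identityʳ _

-- Exactly one set is removed. It is the trace, on the other points, of a block through the first
-- point, and may be empty because that point already makes the block nonempty.
removals : ∀ {n} → List (Subset n) → Subset n → (Subset n → ℕ) → ℕ
removals []       q K = 0
removals (x ∷ xs) q K = removals xs q K + (if does (x ⊆? q) then K (q ∖ x) else 0)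

-- Any two sets through the first point meet, so at most one of them is used: either none is, or one
-- removes the first point together with its trace.
packings-inside : ∀ {n} xs (q : Subset n) K →
  packings (map (inside Vec.∷_) xs) (inside Vec.∷ q) K ≡
  K (inside Vec.∷ q) + removals xs q (λ r → K (outside Vec.∷ r))
packings-inside []       q K = sym (ℕₚ.+-identityʳ _)
packings-inside (x ∷ xs) q K
  rewrite block-inside q x | packings-inside xs q K | packings-inside-outside xs (q ∖ x) K
  = ℕₚ.+-assoc (K (inside Vec.∷ q)) _ _

removals-++ : ∀ {n} xs ys (q : Subset n) K → removals (xs ++ ys) q K ≡ removals xs q K + removals ys q K
removals-++ []       ys q K = refl
removals-++ (x ∷ xs) ys q K rewrite removals-++ xs ys q K = rearrange (removals xs q K) _ _
  where
  rearrange : ∀ a b c → a + b + c ≡ a + c + b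
  rearrange = solve-∀

removals-scale : ∀ {n} xs (q : Subset n) c K → removals xs q (λ r → c · K r) ≡ c · removals xs q K
removals-scale []       q c K = sym (ℕₚ.*-zeroʳ c)
removals-scale (x ∷ xs) q c K rewrite removals-scale xs q c K with does (x ⊆? q)
... | true  = sym (ℕₚ.*-distribˡ-+ c _ _)
... | false = rearrange c _
  where
  rearrange : ∀ c k → c · k + 0 ≡ c · (k + 0)
  rearrange = solve-∀

removals-outside : ∀ {n} xs s (q : Subset n) K →
  removals (map (outside Vec.∷_) xs) (s Vec.∷ q) K ≡ removals xs q (λ r → K (s Vec.∷ r))
removals-outside []       s q K = refl
removals-outside (x ∷ xs) s q K
  rewrite removals-outside xs s q K
        | does-⇔ (out⊆-⇔ {p = x} {q} {s}) (x ⊆? q) (outside Vec.∷ x ⊆? s Vec.∷ q)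
  = refl

removals-inside-outside : ∀ {n} xs (q : Subset n) K →
  removals (map (inside Vec.∷_) xs) (outside Vec.∷ q) K ≡ 0
removals-inside-outside []       q K = refl
removals-inside-outside (x ∷ xs) q K rewrite removals-inside-outside xs q K = refl

removals-inside : ∀ {n} xs (q : Subset n) K →
  removals (map (inside Vec.∷_) xs) (inside Vec.∷ q) K ≡ removals xs q (λ r → K (outside Vec.∷ r))
removals-inside []       q K = refl
removals-inside (x ∷ xs) q K
  rewrite removals-inside xs q K
        | does-⇔ (in⊆in-⇔ {p = x} {q}) (x ⊆? q) (inside Vec.∷ x ⊆? inside Vec.∷ q)
  = refl

subsets-suc : ∀ i → subsets (suc i) ≡ map (outside Vec.∷_) (subsets i) ++ map (inside Vec.∷_) (subsets i)
subsets-suc i = cong (map (outside Vec.∷_) (subsets i) ++_) (++-identityʳ _)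

-- The binomial theorem, one point at a time: a point of `q` either is removed, with factor 1, or
-- stays, with factor `j`.
removals-vacant : ∀ j {i} (q : Subset i) → removals (subsets i) q (vacant j) ≡ vacant (suc j) q
removals-vacant j Vec.[] = refl
removals-vacant j {suc i} (s Vec.∷ q) = begin
  removals (subsets (suc i)) (s Vec.∷ q) (vacant j)
    ≡⟨ cong (λ xs → removals xs (s Vec.∷ q) (vacant j)) (subsets-suc i) ⟩
  removals (map (outside Vec.∷_) (subsets i) ++ map (inside Vec.∷_) (subsets i)) (s Vec.∷ q) (vacant j)
    ≡⟨ removals-++ (map (outside Vec.∷_) (subsets i)) _ (s Vec.∷ q) (vacant j) ⟩
  removals (map (outside Vec.∷_) (subsets i)) (s Vec.∷ q) (vacant j) +
  removals (map (inside Vec.∷_) (subsets i)) (s Vec.∷ q) (vacant j)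
    ≡⟨ cong (_+ removals (map (inside Vec.∷_) (subsets i)) (s Vec.∷ q) (vacant j))
         (removals-outside (subsets i) s q (vacant j)) ⟩
  removals (subsets i) q (λ r → vacant j (s Vec.∷ r)) +
  removals (map (inside Vec.∷_) (subsets i)) (s Vec.∷ q) (vacant j)
    ≡⟨ by-side s ⟩
  vacant (suc j) (s Vec.∷ q) ∎
  where
  open ≡-Reasoning
  by-side : ∀ s →
    removals (subsets i) q (λ r → vacant j (s Vec.∷ r)) +
    removals (map (inside Vec.∷_) (subsets i)) (s Vec.∷ q) (vacant j) ≡ vacant (suc j) (s Vec.∷ q)
  by-side outside = trans
    (cong₂ _+_ (removals-vacant j q) (removals-inside-outside (subsets i) q (vacant j)))
    (ℕₚ.+-identityʳ _)
  by-side inside = trans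
    (cong₂ _+_
      (trans (removals-scale (subsets i) q j (vacant j)) (cong (j ·_) (removals-vacant j q)))
      (trans (removals-inside (subsets i) q (vacant j)) (removals-vacant j q)))
    (ℕₚ.+-comm (j · vacant (suc j) q) _)

packings-vacant : ∀ i j → packings (subsets i) ⊤ (vacant j) ≡ β i j
packings-vacant zero    j = refl
packings-vacant (suc i) j = begin
  packings (subsets (suc i)) ⊤ (vacant j)
    ≡⟨ cong (λ xs → packings xs ⊤ (vacant j)) (subsets-suc i) ⟩
  packings (map (outside Vec.∷_) (subsets i) ++ map (inside Vec.∷_) (subsets i)) ⊤ (vacant j)
    ≡⟨ packings-++ (map (outside Vec.∷_) (subsets i)) _ ⊤ (vacant j) ⟩
  packings (map (outside Vec.∷_) (subsets i)) ⊤ (λ r → packings (map (inside Vec.∷_) (subsets i)) r (vacant j))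
    -- The sets avoiding the first point leave it `inside`, so they act as packings of the other `i`
    -- points.
    ≡⟨ packings-outside (subsets i) inside ⊤ _ ⟩
  packings (subsets i) ⊤ (λ r → packings (map (inside Vec.∷_) (subsets i)) (inside Vec.∷ r) (vacant j))
    -- If the first point stays uncovered, `vacant j (inside Vec.∷ r)` unfolds to `j · vacant j r`;
    -- if it is covered, the possible traces sum to `vacant (suc j) r`.
    ≡⟨ packings-cong (subsets i) ⊤ (λ r → trans
         (packings-inside (subsets i) r (vacant j))
         (cong (λ m → j · vacant j r + m) (removals-vacant j r))) ⟩
  packings (subsets i) ⊤ (λ r → j · vacant j r + vacant (suc j) r)
    ≡⟨ packings-linear (subsets i) ⊤ j (vacant j) (vacant (suc j)) ⟩
  j · packings (subsets i) ⊤ (vacant j) + packings (subsets i) ⊤ (vacant (suc j))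
    ≡⟨ cong₂ (λ a b → j · a + b) (packings-vacant i j) (packings-vacant i (suc j)) ⟩
  β (suc i) j ∎
  where open ≡-Reasoning

B≡β : ∀ i → B i ≡ β i 0
B≡β i = trans
  (cong length (filter-≐ isPartition? (fits? ⊤) (isPartition⇒fits , fits⇒isPartition) (sublists (subsets i))))
  (trans (count-fits (subsets i) ⊤) (packings-vacant i 0))

-- Moments

nC0≡1 : ∀ n → n C 0 ≡ 1
nC0≡1 n = trans (nCk≡nC[n∸k] {0} {n} z≤n) (nCn≡1 n)

-- Induction along Pascal's rule. It lets `moment-falling` trade a factor of the falling factorial
-- for `suc n`.
C-absorb : ∀ n k → suc k · (suc n C suc k) ≡ suc n · (n C k)
C-absorb zero    zero    = refl
C-absorb zero    (suc k)
  rewrite k>n⇒nCk≡0 {1} {suc (suc k)} (s≤s (s≤s z≤n)) | k>n⇒nCk≡0 {0} {suc k} (s≤s z≤n)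
  = ℕₚ.*-zeroʳ (suc (suc k))
C-absorb (suc n) zero    rewrite nC1≡n (suc (suc n)) | nC0≡1 (suc n) = ℕₚ.*-comm 1 (suc (suc n))
C-absorb (suc n) (suc k) = begin
  suc (suc k) · (suc (suc n) C suc (suc k))
    ≡⟨ cong (suc (suc k) ·_) (nCk+nC[k+1]≡[n+1]C[k+1] (suc n) (suc k)) ⟨
  suc (suc k) · (c₁ + c₂)
    ≡⟨ split k c₁ c₂ ⟩
  c₁ + suc k · c₁ + suc (suc k) · c₂
    ≡⟨ cong₂ (λ a b → c₁ + a + b) (C-absorb n k) (C-absorb n (suc k)) ⟩
  c₁ + suc n · (n C k) + suc n · (n C suc k)
    ≡⟨ collect c₁ n (n C k) (n C suc k) ⟩
  c₁ + suc n · (n C k + n C suc k)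
    ≡⟨ cong (λ a → c₁ + suc n · a) (nCk+nC[k+1]≡[n+1]C[k+1] n k) ⟩
  suc (suc n) · c₁ ∎
  where
  open ≡-Reasoning
  c₁ = suc n C suc k
  c₂ = suc n C suc (suc k)
  split : ∀ k a b → suc (suc k) · (a + b) ≡ a + suc k · a + suc (suc k) · b
  split = solve-∀
  collect : ∀ c n a b → c + suc n · a + suc n · b ≡ c + suc n · (a + b)
  collect = solve-∀

-- With N free to exceed t, Pascal’s rule needs no separate boundary term.
binomial-d : ∀ t n N → t ≤ n → t ≤ N →
  Σℕ.sum {suc N} (λ k → (t C toℕ k) · d (n ∸ toℕ k)) ≡ count n (derangedFrom? t)
binomial-d zero n N _ _ = begin
  (0 C 0) · d n + Σℕ.sum {N} (λ k → (0 C suc (toℕ k)) · d (n ∸ suc (toℕ k)))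
    ≡⟨ cong₂ _+_ (ℕₚ.*-identityˡ (d n))
         (Σℕ.sum-cong-≗ {N} (λ k → cong (_· d (n ∸ suc (toℕ k))) (k>n⇒nCk≡0 {0} {suc (toℕ k)} (s≤s z≤n)))) ⟩
  d n + Σℕ.sum {N} (λ _ → 0)
    ≡⟨ cong (λ s → d n + s) (Σℕ.sum-replicate-zero N) ⟩
  d n + 0
    ≡⟨ ℕₚ.+-identityʳ (d n) ⟩
  d n
    ≡⟨ derangedFrom-zero n ⟨
  count n (derangedFrom? 0) ∎
  where open ≡-Reasoning
binomial-d (suc t) (suc n) (suc N) (s≤s t≤n) (s≤s t≤N) = begin
  (suc t C 0) · d (suc n) + Σℕ.sum {suc N} (λ k → (suc t C suc (toℕ k)) · d (n ∸ toℕ k))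
    ≡⟨ cong₂ (λ a b → a · d (suc n) + b) (trans (nC0≡1 (suc t)) (sym (nC0≡1 t)))
         (trans
           (Σℕ.sum-cong-≗ {suc N} (λ k → trans
             (cong (_· d (n ∸ toℕ k)) (sym (nCk+nC[k+1]≡[n+1]C[k+1] t (toℕ k))))
             (ℕₚ.*-distribʳ-+ (d (n ∸ toℕ k)) (t C toℕ k) _)))
           (Σℕ.∑-distrib-+ {suc N} (λ k → (t C toℕ k) · d (n ∸ toℕ k)) (λ k → (t C suc (toℕ k)) · d (n ∸ toℕ k)))) ⟩
  (t C 0) · d (suc n) +
    (Σℕ.sum {suc N} (λ k → (t C toℕ k) · d (n ∸ toℕ k)) +
     Σℕ.sum {suc N} (λ k → (t C suc (toℕ k)) · d (n ∸ toℕ k)))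
    -- The term `(t C 0) · d (suc n)` and the sum over `t C suc (toℕ k)` are head and tail of the
    -- sum for `t`, `suc n` and `suc N`.
    ≡⟨ exchange ((t C 0) · d (suc n)) _ _ ⟩
  Σℕ.sum {suc (suc N)} (λ k → (t C toℕ k) · d (suc n ∸ toℕ k)) +
  Σℕ.sum {suc N} (λ k → (t C toℕ k) · d (n ∸ toℕ k))
    ≡⟨ cong₂ _+_ (binomial-d t (suc n) (suc N) (ℕₚ.m≤n⇒m≤1+n t≤n) (ℕₚ.m≤n⇒m≤1+n t≤N)) (binomial-d t n N t≤n t≤N) ⟩
  count (suc n) (derangedFrom? t) + count n (derangedFrom? t)
    ≡⟨ subst (λ s → count (suc n) (derangedFrom? (suc s)) ≡
                    count (suc n) (derangedFrom? s) + count n (derangedFrom? s))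
         (toℕ-fromℕ< (s≤s t≤n)) (derangedFrom-split (fromℕ< (s≤s t≤n))) ⟨
  count (suc n) (derangedFrom? (suc t)) ∎
  where
  open ≡-Reasoning
  exchange : ∀ a b c → a + (b + c) ≡ (a + c) + b
  exchange = solve-∀

-- Peeling off the largest factor avoids truncated subtraction and matches the shape of `C-absorb`.
falling : ℕ → ℕ → ℕ
falling k       zero    = 1
falling zero    (suc j) = 0
falling (suc k) (suc j) = suc k · falling k j

-- Write k = j + (k - j): the factor k - j prolongs the falling factorial by one. For k < j both
-- sides vanish.
falling-step : ∀ k j → k · falling k j ≡ j · falling k j + falling k (suc j)
falling-step zero    zero    = refl
falling-step zero    (suc j) = sym (trans (ℕₚ.+-identityʳ _) (ℕₚ.*-zeroʳ j))
falling-step (suc k) zero    = refl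
falling-step (suc k) (suc j) = begin
  suc k · (suc k · φ)                       ≡⟨ pull k φ ⟩
  suc k · (φ + k · φ)                       ≡⟨ cong (λ a → suc k · (φ + a)) (falling-step k j) ⟩
  suc k · (φ + (j · φ + falling k (suc j))) ≡⟨ push k j φ (falling k (suc j)) ⟩
  suc j · (suc k · φ) + suc k · falling k (suc j) ∎
  where
  open ≡-Reasoning
  φ = falling k j
  pull : ∀ k φ → suc k · (suc k · φ) ≡ suc k · (φ + k · φ)
  pull = solve-∀
  push : ∀ k j φ ψ → suc k · (φ + (j · φ + ψ)) ≡ suc j · (suc k · φ) + suc k · ψ
  push = solve-∀

-- The number of permutations of n points with exactly k fixed points.
fixing : ℕ → ℕ → ℕ
fixing n k = (n C k) · d (n ∸ k)

-- The sum of `g` at the number of fixed points, over all permutations of `n` points.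
moment : ℕ → (ℕ → ℕ) → ℕ
moment n g = Σℕ.sum {suc n} (λ k → g (toℕ k) · fixing n (toℕ k))

moment-cong : ∀ n {g h : ℕ → ℕ} → (∀ k → g k ≡ h k) → moment n g ≡ moment n h
moment-cong n g≗h = Σℕ.sum-cong-≗ {suc n} (λ k → cong (_· fixing n (toℕ k)) (g≗h (toℕ k)))

moment-linear : ∀ n c g h → moment n (λ k → c · g k + h k) ≡ c · moment n g + moment n h
moment-linear n c g h = begin
  moment n (λ k → c · g k + h k)
    ≡⟨ Σℕ.sum-cong-≗ {suc n} (λ k → distribute c (g (toℕ k)) (h (toℕ k)) (fixing n (toℕ k))) ⟩
  Σℕ.sum {suc n} (λ k → c · term g k + term h k)
    ≡⟨ Σℕ.∑-distrib-+ {suc n} (λ k → c · term g k) (term h) ⟩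
  Σℕ.sum {suc n} (λ k → c · term g k) + moment n h
    ≡⟨ cong (_+ moment n h) (Σℕ.*-distribˡ-sum c (term g)) ⟨
  c · moment n g + moment n h ∎
  where
  open ≡-Reasoning
  term : (ℕ → ℕ) → Fin (suc n) → ℕ
  term f k = f (toℕ k) · fixing n (toℕ k)
  distribute : ∀ c a b w → (c · a + b) · w ≡ c · (a · w) + b · w
  distribute = solve-∀

-- Each absorption lowers `n` and `j` by one and yields the factor `suc n`; at `j = 0` all
-- permutations are counted.
moment-falling : ∀ {n j} → j ≤ n → moment n (λ k → falling k j) ≡ n !
moment-falling {n} {zero} _ = begin
  moment n (λ _ → 1)
    ≡⟨ Σℕ.sum-cong-≗ {suc n} (λ k → ℕₚ.*-identityˡ (fixing n (toℕ k))) ⟩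
  Σℕ.sum {suc n} (λ k → (n C toℕ k) · d (n ∸ toℕ k))
    ≡⟨ binomial-d n n n ℕₚ.≤-refl ℕₚ.≤-refl ⟩
  count n (derangedFrom? n)
    ≡⟨ derangedFrom-all n ⟩
  n ! ∎
  where open ≡-Reasoning
moment-falling {suc n} {suc j} (s≤s j≤n) = begin
  -- The term at 0 has vanished by computation, as `falling zero (suc j)` is 0, so the sum is
  -- indexed by predecessors.
  Σℕ.sum {suc n} (λ k → suc (toℕ k) · falling (toℕ k) j · ((suc n C suc (toℕ k)) · d (n ∸ toℕ k)))
    ≡⟨ Σℕ.sum-cong-≗ {suc n} (λ k → absorb (toℕ k)) ⟩
  Σℕ.sum {suc n} (λ k → suc n · term k)
    ≡⟨ Σℕ.*-distribˡ-sum (suc n) term ⟨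
  suc n · moment n (λ k → falling k j)
    ≡⟨ cong (suc n ·_) (moment-falling j≤n) ⟩
  suc n ! ∎
  where
  open ≡-Reasoning
  term : Fin (suc n) → ℕ
  term k = falling (toℕ k) j · fixing n (toℕ k)
  regroup : ∀ a φ c e → a · φ · (c · e) ≡ a · c · (φ · e)
  regroup = solve-∀
  absorb : ∀ k → suc k · falling k j · ((suc n C suc k) · d (n ∸ k)) ≡
                 suc n · (falling k j · fixing n k)
  absorb k = begin
    suc k · falling k j · ((suc n C suc k) · d (n ∸ k))
      ≡⟨ regroup (suc k) (falling k j) (suc n C suc k) (d (n ∸ k)) ⟩
    suc k · (suc n C suc k) · (falling k j · d (n ∸ k))
      ≡⟨ cong (_· (falling k j · d (n ∸ k))) (C-absorb n k) ⟩
    suc n · (n C k) · (falling k j · d (n ∸ k))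
      ≡⟨ regroup′ (suc n) (n C k) (falling k j) (d (n ∸ k)) ⟩
    suc n · (falling k j · fixing n k) ∎
    where
    regroup′ : ∀ a c φ e → a · c · (φ · e) ≡ a · (φ · (c · e))
    regroup′ = solve-∀

-- Each factor `k` is spent by `falling-step`, which keeps `j` or raises it by one. The falling
-- index thus never exceeds `i + j`, and the bound by `n` lets `moment-falling` apply at the end.
moment-power-falling : ∀ i j {n} → i + j ≤ n → moment n (λ k → k ^ i · falling k j) ≡ β i j · n !
moment-power-falling zero    j {n} j≤n = trans
  (moment-cong n (λ k → ℕₚ.*-identityˡ (falling k j)))
  (trans (moment-falling j≤n) (sym (ℕₚ.*-identityˡ (n !))))
moment-power-falling (suc i) j {n} 1+i+j≤n = begin
  moment n (λ k → k ^ suc i · falling k j)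
    ≡⟨ moment-cong n step ⟩
  moment n (λ k → j · (k ^ i · falling k j) + k ^ i · falling k (suc j))
    ≡⟨ moment-linear n j (λ k → k ^ i · falling k j) (λ k → k ^ i · falling k (suc j)) ⟩
  j · moment n (λ k → k ^ i · falling k j) + moment n (λ k → k ^ i · falling k (suc j))
    ≡⟨ cong₂ (λ a b → j · a + b)
         (moment-power-falling i j (ℕₚ.<⇒≤ 1+i+j≤n))
         (moment-power-falling i (suc j) (subst (_≤ n) (sym (ℕₚ.+-suc i j)) 1+i+j≤n)) ⟩
  j · (β i j · n !) + β i (suc j) · n !
    ≡⟨ factor j (β i j) (β i (suc j)) (n !) ⟩
  β (suc i) j · n ! ∎
  where
  open ≡-Reasoning
  factor : ∀ j a b w → j · (a · w) + b · w ≡ (j · a + b) · w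
  factor = solve-∀
  regroup : ∀ k p φ → k · p · φ ≡ p · (k · φ)
  regroup = solve-∀
  distribute : ∀ p j φ ψ → p · (j · φ + ψ) ≡ j · (p · φ) + p · ψ
  distribute = solve-∀
  step : ∀ k → k ^ suc i · falling k j ≡ j · (k ^ i · falling k j) + k ^ i · falling k (suc j)
  step k = trans (regroup k (k ^ i) (falling k j))
    (trans (cong (k ^ i ·_) (falling-step k j)) (distribute (k ^ i) j (falling k j) (falling k (suc j))))

moment-power : ∀ {n i} → i ≤ n → moment n (_^ i) ≡ B i · n !
moment-power {n} {i} i≤n = begin
  moment n (_^ i)                       ≡⟨ moment-cong n (λ k → ℕₚ.*-identityʳ (k ^ i)) ⟨
  moment n (λ k → k ^ i · falling k 0)  ≡⟨ moment-power-falling i 0 (subst (_≤ n) (sym (ℕₚ.+-identityʳ i)) i≤n) ⟩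
  β i 0 · n !                           ≡⟨ cong (_· n !) (B≡β i) ⟨
  B i · n !                             ∎
  where open ≡-Reasoning

-- Passage to integer coefficients

pos-sum : ∀ n (f : Fin n → ℕ) → + Σℕ.sum f ≡ Σℤ.sum (λ k → + f k)
pos-sum zero    f = refl
pos-sum (suc n) f = cong (λ s → + f zero ℤ.+ s) (pos-sum n (λ k → f (suc k)))

pos-^ : ∀ k i → (+ k) ℤ.^ i ≡ + (k ^ i)
pos-^ k zero    = refl
pos-^ k (suc i) = trans (cong (+ k *_) (pos-^ k i)) (sym (ℤₚ.pos-* k (k ^ i)))

theorem2 : (n m : ℕ) → n ≥ m → (a : Vector ℤ (suc m)) →
    ∑[ k ≤ n ] (eval a (+ toℕ k) * + (n C toℕ k) * + d (n ∸ toℕ k))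
    ≡ (∑[ i ≤ m ] (a i * + B (toℕ i))) * + (n !)
theorem2 n m m≤n a = begin
  Σℤ.sum {suc n} (λ k → eval a (+ toℕ k) * + (n C toℕ k) * + d (n ∸ toℕ k))
    ≡⟨ Σℤ.sum-cong-≗ {suc n} (λ k → trans
         (ℤₚ.*-assoc (eval a (+ toℕ k)) (+ (n C toℕ k)) (+ d (n ∸ toℕ k)))
         (trans (Σℤ.*-distribʳ-sum (+ (n C toℕ k) * + d (n ∸ toℕ k)) (λ i → a i * (+ toℕ k) ℤ.^ toℕ i))
           (Σℤ.sum-cong-≗ {suc m} (λ i → monomial (a i) (toℕ k) (toℕ i))))) ⟩
  Σℤ.sum {suc n} (λ k → Σℤ.sum {suc m} (λ i → a i * + weight i k))
    -- Interchanging the sums leaves, for each `a i`, the moment of a single power, which is a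
    -- statement about naturals.
    ≡⟨ Σℤ.∑-comm {suc n} {suc m} (λ k i → a i * + weight i k) ⟩
  Σℤ.sum {suc m} (λ i → Σℤ.sum {suc n} (λ k → a i * + weight i k))
    ≡⟨ Σℤ.sum-cong-≗ {suc m} (λ i → trans
         (sym (Σℤ.*-distribˡ-sum (a i) (λ k → + weight i k)))
         (trans (cong (a i *_) (coefficient i)) (sym (ℤₚ.*-assoc (a i) (+ B (toℕ i)) (+ (n !)))))) ⟩
  Σℤ.sum {suc m} (λ i → a i * + B (toℕ i) * + (n !))
    ≡⟨ Σℤ.*-distribʳ-sum (+ (n !)) (λ i → a i * + B (toℕ i)) ⟨
  Σℤ.sum {suc m} (λ i → a i * + B (toℕ i)) * + (n !) ∎
  where
  open ≡-Reasoning
  weight : Fin (suc m) → Fin (suc n) → ℕ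
  weight i k = toℕ k ^ toℕ i · fixing n (toℕ k)
  monomial : ∀ c k i → c * (+ k) ℤ.^ i * (+ (n C k) * + d (n ∸ k)) ≡
                       c * + (k ^ i · fixing n k)
  monomial c k i = begin
    c * (+ k) ℤ.^ i * (+ (n C k) * + d (n ∸ k))
      ≡⟨ ℤₚ.*-assoc c ((+ k) ℤ.^ i) (+ (n C k) * + d (n ∸ k)) ⟩
    c * ((+ k) ℤ.^ i * (+ (n C k) * + d (n ∸ k)))
      ≡⟨ cong (c *_) (cong₂ _*_ (pos-^ k i) (sym (ℤₚ.pos-* (n C k) (d (n ∸ k))))) ⟩
    c * (+ (k ^ i) * + fixing n k)
      ≡⟨ cong (c *_) (ℤₚ.pos-* (k ^ i) (fixing n k)) ⟨
    c * + (k ^ i · fixing n k) ∎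
  coefficient : ∀ i → Σℤ.sum {suc n} (λ k → + weight i k) ≡ + B (toℕ i) * + (n !)
  coefficient i = begin
    Σℤ.sum {suc n} (λ k → + weight i k)  ≡⟨ pos-sum (suc n) (weight i) ⟨
    -- Here `n ≥ m` enters: it bounds every exponent `toℕ i` by `n`.
    + moment n (_^ toℕ i)                ≡⟨ cong +_ (moment-power (ℕₚ.≤-trans (toℕ≤pred[n] i) m≤n)) ⟩
    + (B (toℕ i) · n !)                  ≡⟨ ℤₚ.pos-* (B (toℕ i)) (n !) ⟩
    + B (toℕ i) * + (n !)                ∎
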